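{- Let $n\ge2$ and $B_n=\langle a,b\mid ba=b^n\rangle$. 1. If $\mathsf d$ denotes the Levenshtein distance, then $\mathsf c_{\mathsf d}(B_n)=n-1$; and $B_n$ is half-factorial if and only if $n=2$. 2. For all $k,m\in\mathbb N_0$, \[\mathsf L(a^kb^m)=k+m-q_{m,n}(n-2)+(n-2)\cdot[0,q_{m,n}],\] where $q_{m,n}=\lfloor m/(n-1)\rfloor$ if $(n-1)\nmid m$; $q_{m,n}=\frac{m}{n-1}-1$ if $(n-1)\mid m$ and $m\neq0$; and $q_{m,n}=0$ if $m=0$.
   Context: $B_n$ is the monoid with generators $a,b$ and single relation $ba=b^n$; it is reduced and atomic with atoms $a,b$, and every element is uniquely $a^kb^m$ ($k,m\in\mathbb N_0$). Factorizations are words in the free monoid $\mathcal F^*(\{a,b\})$; $\pi$ maps a word to the element it represents; $\sim=\{(x,y)\mid\pi(x)=\pi(y)\}$. $\mathsf L(x)=\{|z|:\pi(z)=x\}$ (with $\mathsf L(1)=\{0\}$). The Levenshtein distance between words $z,z'$ is the minimal number of substitutions, deletions or insertions of single letters needed to transform $z$ into $z'$. For $x\in B_n$, the catenary degree $\mathsf c_{\mathsf d}(x)$ is the least $N\in\mathbb N_0\cup\{\infty\}$ such that any two factorizations $z,z'$ of $x$ are connected by a chain $z=z_0,\dots,z_r=z'$ of factorizations of $x$ with $\mathsf d(z_{i-1},z_i)\le N$; $\mathsf c_{\mathsf d}(B_n)=\sup_x\mathsf c_{\mathsf d}(x)$. Half-factorial: $|\mathsf L(x)|=1$ for all $x$.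 Notation: $[u,v]=\{z\in\mathbb Z:u\le z\le v\}$, $d\cdot L=\{dl:l\in L\}$, $m+L=\{m+l:l\in L\}$. -}

module Defs where

open import Algebra.Bundles using (Monoid)
import Algebra.Definitions.RawMonoid as RawMonoidDefs
open import Data.Empty using (⊥-elim)
open import Data.Integer as ℤ using (ℤ)
open import Data.List using (List; []; _∷_; [_]; _++_; map; foldr; length; replicate)
open import Data.List.Membership.Propositional using (_∈_; lose; find)
open import Data.List.Membership.Propositional.Properties using (∈-map⁺; ∈-map⁻)
open import Data.List.Properties using (++-assoc; ++-identityʳ; ≡-dec)
open import Data.List.Relation.Unary.Any using (here; there; any?)
open import Data.Nat using (ℕ; zero; suc; _∸_; _/_; _≤_; z≤n; s≤s; >-nonZero)
open import Data.Nat.Divisibility using (_∣?_)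
open import Data.Nat.Properties using (m<n⇒0<n∸m)
open import Data.Product using (_×_; _,_; ∃; ∃!; proj₁; proj₂)
open import Level using (0ℓ)
open import Relation.Binary.Construct.Closure.ReflexiveTransitive using (Star)
open import Relation.Binary.Core using (Rel)
open import Relation.Binary.PropositionalEquality using (_≡_; refl)
open import Relation.Nullary using (Dec; yes; no)
open import Relation.Nullary.Construct.Add.Supremum as Sup using (_⁺)
open import Relation.Nullary.Decidable using (map′)
open import Relation.Unary using (Pred)

open import Relation.Binary.Construct.Add.Supremum.NonStrict _≤_ using () renaming (_≤⁺_ to _≤∞_) public

ℕ∞ : Set
ℕ∞ = ℕ ⁺

fin : ℕ → ℕ∞
fin n = Sup.[ n ]

IsLeast : {A : Set} → Rel A 0ℓ → Pred A 0ℓ → Pred A 0ℓ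
IsLeast _⊑_ P m = P m × (∀ k → P k → m ⊑ k)

IsSupremum : {A I : Set} → Rel A 0ℓ → (I → A) → Pred A 0ℓ
IsSupremum _⊑_ f = IsLeast _⊑_ (λ u → ∀ i → f i ⊑ u)

data Letter : Set where
  a b : Letter

Word : Set
Word = List Letter

infix 4 _∼⟨_⟩_

-- The least monoid congruence on words containing (ba , bⁿ).
data _∼⟨_⟩_ : Word → ℕ → Word → Set where
  ba∼bⁿ  : ∀ {n} → b ∷ a ∷ [] ∼⟨ n ⟩ replicate n b
  ∼-refl  : ∀ {n u} → u ∼⟨ n ⟩ u
  ∼-sym   : ∀ {n u v} → u ∼⟨ n ⟩ v → v ∼⟨ n ⟩ u
  ∼-trans : ∀ {n u v w} → u ∼⟨ n ⟩ v → v ∼⟨ n ⟩ w → u ∼⟨ n ⟩ w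
  ∼-cong  : ∀ {n u u′ v v′} → u ∼⟨ n ⟩ u′ → v ∼⟨ n ⟩ v′ → u ++ v ∼⟨ n ⟩ u′ ++ v′

-- The quotient of the free monoid by this congruence, as a setoid.
B : ℕ → Monoid 0ℓ 0ℓ
B n = record
  { Carrier  = Word
  ; _≈_      = _∼⟨ n ⟩_
  ; _∙_      = _++_
  ; ε        = []
  ; isMonoid = record
    { isSemigroup = record
      { isMagma = record
        { isEquivalence = record { refl = ∼-refl ; sym = ∼-sym ; trans = ∼-trans }
        ; ∙-cong        = ∼-cong
        }
      ; assoc = λ x y z → ≡⇒∼ (++-assoc x y z)
      }
    ; identity = (λ _ → ∼-refl) , (λ x → ≡⇒∼ (++-identityʳ x))
    }
  }
  where
  ≡⇒∼ : ∀ {u v} → u ≡ v → u ∼⟨ n ⟩ v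
  ≡⇒∼ refl = ∼-refl

data Edit : Word → Word → Set where
  substitution : ∀ u x y v → Edit (u ++ x ∷ v) (u ++ y ∷ v)
  deletion     : ∀ u x v → Edit (u ++ x ∷ v) (u ++ v)
  insertion    : ∀ u x v → Edit (u ++ v) (u ++ x ∷ v)

data Edits : ℕ → Word → Word → Set where
  []  : ∀ {z} → Edits 0 z z
  _∷_ : ∀ {k z w z′} → Edit z w → Edits k w z′ → Edits (suc k) z z′

Edit-cons : ∀ x {z w} → Edit z w → Edit (x ∷ z) (x ∷ w)
Edit-cons x (substitution u y y′ v) = substitution (x ∷ u) y y′ v
Edit-cons x (deletion u y v)        = deletion (x ∷ u) y v
Edit-cons x (insertion u y v)       = insertion (x ∷ u) y v

Edits-cons : ∀ x {k z w} → Edits k z w → Edits k (x ∷ z) (x ∷ w)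
Edits-cons x []       = []
Edits-cons x (e ∷ es) = Edit-cons x e ∷ Edits-cons x es

Edits-exist : ∀ z z′ → ∃ λ k → Edits k z z′
Edits-exist []      []       = 0 , []
Edits-exist []      (y ∷ z′) with Edits-exist [] z′
... | k , es = suc k , insertion [] y [] ∷ Edits-cons y es
Edits-exist (x ∷ z) z′       with Edits-exist z z′
... | k , es = suc k , deletion [] x z ∷ es

_≟ᴸ_ : (x y : Letter) → Dec (x ≡ y)
a ≟ᴸ a = yes refl
a ≟ᴸ b = no λ ()
b ≟ᴸ a = no λ ()
b ≟ᴸ b = yes refl

neighbours : Word → List Word
neighbours []      = [ a ] ∷ [ b ] ∷ []
neighbours (x ∷ v) =
  v ∷ (a ∷ v) ∷ (b ∷ v) ∷ (a ∷ x ∷ v) ∷ (b ∷ x ∷ v) ∷ map (x ∷_) (neighbours v)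

neighbours-sound : ∀ z {w} → w ∈ neighbours z → Edit z w
neighbours-sound []      (here refl)                             = insertion [] a []
neighbours-sound []      (there (here refl))                     = insertion [] b []
neighbours-sound (x ∷ v) (here refl)                             = deletion [] x v
neighbours-sound (x ∷ v) (there (here refl))                     = substitution [] x a v
neighbours-sound (x ∷ v) (there (there (here refl)))             = substitution [] x b v
neighbours-sound (x ∷ v) (there (there (there (here refl))))     = insertion [] a (x ∷ v)
neighbours-sound (x ∷ v) (there (there (there (there (here refl))))) = insertion [] b (x ∷ v)
neighbours-sound (x ∷ v) (there (there (there (there (there p))))) with ∈-map⁻ (x ∷_) p
... | _ , q , refl = Edit-cons x (neighbours-sound v q)

neighbours-cons : ∀ x {v w} → w ∈ neighbours v → (x ∷ w) ∈ neighbours (x ∷ v)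
neighbours-cons x p = there (there (there (there (there (∈-map⁺ (x ∷_) p)))))

neighbours-complete : ∀ {z w} → Edit z w → w ∈ neighbours z
neighbours-complete (substitution [] x a v)      = there (here refl)
neighbours-complete (substitution [] x b v)      = there (there (here refl))
neighbours-complete (substitution (c ∷ u) x y v) = neighbours-cons c (neighbours-complete (substitution u x y v))
neighbours-complete (deletion [] x v)            = here refl
neighbours-complete (deletion (c ∷ u) x v)       = neighbours-cons c (neighbours-complete (deletion u x v))
neighbours-complete (insertion [] a [])          = here refl
neighbours-complete (insertion [] b [])          = there (here refl)
neighbours-complete (insertion [] a (y ∷ v))     = there (there (there (here refl)))
neighbours-complete (insertion [] b (y ∷ v))     = there (there (there (there (here refl))))
neighbours-complete (insertion (c ∷ u) x v)      = neighbours-cons c (neighbours-complete (insertion u x v))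

Edits? : ∀ z z′ k → Dec (Edits k z z′)
Edits? z z′ zero    = map′ (λ { refl → [] }) (λ { [] → refl }) (≡-dec _≟ᴸ_ z z′)
Edits? z z′ (suc k) = map′
  (λ p → let (_ , w∈ , es) = find p in neighbours-sound z w∈ ∷ es)
  (λ { (e ∷ es) → lose (neighbours-complete e) es })
  (any? (λ w → Edits? w z′ k) (neighbours z))

least : {P : Pred ℕ 0ℓ} → (∀ k → Dec (P k)) → ∀ k → P k → ∃ (IsLeast _≤_ P)
least P? zero    p = 0 , p , λ _ _ → z≤n
least {P} P? (suc k) p with P? 0
... | yes p₀ = 0 , p₀ , λ _ _ → z≤n
... | no ¬p₀ with least (λ i → P? (suc i)) k p
...   | m , pm , m-min = suc m , pm , minimal
  where
  minimal : ∀ i → P i → suc m ≤ i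
  minimal zero    p₀ = ⊥-elim (¬p₀ p₀)
  minimal (suc i) pᵢ = s≤s (m-min i pᵢ)

minimalEdits : ∀ z z′ → ∃ (IsLeast _≤_ (λ k → Edits k z z′))
minimalEdits z z′ = let (k , es) = Edits-exist z z′ in least (Edits? z z′) k es

levenshtein : Word → Word → ℕ
levenshtein z z′ = proj₁ (minimalEdits z z′)

module _ (n : ℕ) where

  open Monoid (B n) using (Carrier; _≈_; _∙_; ε; rawMonoid)

  gen : Letter → Carrier
  gen x = [ x ]

  π : Word → Carrier
  π z = foldr _∙_ ε (map gen z)

  normalForm : ℕ → ℕ → Carrier
  normalForm k m = (k · gen a) ∙ (m · gen b)
    where open RawMonoidDefs rawMonoid using () renaming (_×_ to _·_)

  IsFactorization : Carrier → Pred Word 0ℓ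
  IsFactorization x z = π z ≈ x

  L : Carrier → Pred ℕ 0ℓ
  L x l = ∃ λ z → IsFactorization x z × length z ≡ l

  HalfFactorial : Set
  HalfFactorial = ∀ x → ∃! _≡_ (L x)

  module _ (d : Word → Word → ℕ) where

    Link : Carrier → ℕ∞ → Rel Word 0ℓ
    Link x N z z′ = IsFactorization x z × IsFactorization x z′ × fin (d z z′) ≤∞ N

    ChainConnected : Carrier → Pred ℕ∞ 0ℓ
    ChainConnected x N =
      ∀ z z′ → IsFactorization x z → IsFactorization x z′ → Star (Link x N) z z′

    IsCatenaryDegreeAt : Carrier → Pred ℕ∞ 0ℓ
    IsCatenaryDegreeAt x = IsLeast _≤∞_ (ChainConnected x)

    -- c is determined by leastness; asking for it as a function makes the
    -- existence of every c(x) part of the claim, so that the supremum is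
    -- never taken over a partial family.
    IsCatenaryDegree : Pred ℕ∞ 0ℓ
    IsCatenaryDegree N =
      ∃ λ (c : Carrier → ℕ∞) → (∀ x → IsCatenaryDegreeAt x (c x)) × IsSupremum _≤∞_ c N

infixr 6 _+ˢ_
infixr 7 _·ˢ_

[_⋯_] : ℤ → ℤ → Pred ℤ 0ℓ
[ u ⋯ v ] z = u ℤ.≤ z × z ℤ.≤ v

_+ˢ_ : ℤ → Pred ℤ 0ℓ → Pred ℤ 0ℓ
(m +ˢ S) z = ∃ λ l → S l × z ≡ m ℤ.+ l

_·ˢ_ : ℤ → Pred ℤ 0ℓ → Pred ℤ 0ℓ
(d ·ˢ S) z = ∃ λ l → S l × z ≡ d ℤ.* l

asℤ : Pred ℕ 0ℓ → Pred ℤ 0ℓ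
asℤ S z = ∃ λ l → S l × z ≡ ℤ.+ l

-- In the divisible case m ≠ 0, so the quotient is positive and ∸ 1 does not truncate.
q : (m n : ℕ) → .(2 ≤ n) → ℕ
q zero      n 2≤n = 0
q m@(suc _) n 2≤n with (n ∸ 1) ∣? m
... | yes _ = (m / (n ∸ 1)) {{>-nonZero (m<n⇒0<n∸m 2≤n)}} ∸ 1
... | no  _ = (m / (n ∸ 1)) {{>-nonZero (m<n⇒0<n∸m 2≤n)}}

{-# OPTIONS --safe #-}
-- Put p = n − 1.  Reading a word from the left, a letter a met before the first b increases k in the
-- normal form aᵏbᵐ, while every later a increases m by p, because bᵐa = bᵐ⁺ᵖ for m ≥ 1.  So the
-- factorizations of aᵏbᵐ are the words aᵏw, with w empty or starting with b, such that w has β letters b,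
-- α letters a and β + αp = m.  Their lengths are k + α + β, and α ranges over 0, …, q.
-- Replacing one a by bᵖ costs p edits and eventually leads to aᵏbᵐ.  Conversely, fewer than p edits
-- cannot change β, which is determined modulo p; hence p is optimal as soon as α = 1 is possible.
module Submission where

open import Defs
open import Data.Empty using (⊥-elim)
open import Data.Integer using (+_; _+_; _-_; _*_; +≤+)
open import Data.Integer.Properties using (pos-*)
open import Data.Integer.Tactic.RingSolver using (solve-∀)
open import Data.List using ([]; _∷_; _++_; foldl; length; replicate)
open import Data.List.Properties using (++-identityʳ; foldl-++; length-++; length-replicate)
open import Data.Nat as ℕ using (ℕ; zero; suc; _≤_; _<_; _∸_; z≤n; s≤s)
open import Data.Nat.DivMod using (m/n*n≡m; m/n*n≤m; m*n/n≡m; /-monoˡ-≤)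
open import Data.Nat.Divisibility using (_∣?_; divides)
open import Data.Nat.Properties
import Data.Nat.Tactic.RingSolver as ℕ-Solver
open import Data.Product using (_×_; _,_; ∃; proj₁; proj₂)
open import Data.Sum using (_⊎_; inj₁; inj₂; map₂)
open import Function.Bundles using (_⇔_; mk⇔)
open import Relation.Binary.Construct.Add.Supremum.NonStrict _≤_ using ([_]; _≤⊤⁺; ≤⁺-trans; [≤]-injective)
open import Relation.Binary.Construct.Closure.ReflexiveTransitive using (Star; ε; _◅_; _◅◅_; reverse)
open import Relation.Binary.Definitions using (tri<; tri≈; tri>)
open import Relation.Binary.PropositionalEquality using (_≡_; refl; sym; trans; cong; cong₂; subst; module ≡-Reasoning)
open import Relation.Nullary using (yes; no)
open import Relation.Nullary.Construct.Add.Supremum using (⊤⁺) renaming ([_] to [_]⁺)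
open import Relation.Unary using (_≐_)

-- Blocks of a repeated letter

replicate-shift : ∀ {A : Set} m (x : A) v → replicate m x ++ x ∷ v ≡ x ∷ replicate m x ++ v
replicate-shift zero    x v = refl
replicate-shift (suc m) x v = cong (x ∷_) (replicate-shift m x v)

replicate-merge : ∀ {A : Set} j m (x : A) v →
  replicate m x ++ replicate j x ++ v ≡ replicate (j ℕ.+ m) x ++ v
replicate-merge zero    m x v = refl
replicate-merge (suc j) m x v =
  trans (replicate-shift m x (replicate j x ++ v)) (cong (x ∷_) (replicate-merge j m x v))

-- Edits and the Levenshtein distance

Edit-sym : ∀ {z w} → Edit z w → Edit w z
Edit-sym (substitution u x y v) = substitution u y x v
Edit-sym (deletion u x v)       = insertion u x v
Edit-sym (insertion u x v)      = deletion u x v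

Edits-snoc : ∀ {k z w z′} → Edits k z w → Edit w z′ → Edits (suc k) z z′
Edits-snoc []       e = e ∷ []
Edits-snoc (f ∷ es) e = f ∷ Edits-snoc es e

Edits-sym : ∀ {k z w} → Edits k z w → Edits k w z
Edits-sym []       = []
Edits-sym (e ∷ es) = Edits-snoc (Edits-sym es) (Edit-sym e)

Edits-++ˡ : ∀ u {k z w} → Edits k z w → Edits k (u ++ z) (u ++ w)
Edits-++ˡ []      es = es
Edits-++ˡ (x ∷ u) es = Edits-cons x (Edits-++ˡ u es)

insert-replicate : ∀ r x v → Edits r v (replicate r x ++ v)
insert-replicate zero    x v = []
insert-replicate (suc r) x v = insertion [] x v ∷ Edits-cons x (insert-replicate r x v)

-- Substituting for the single letter and then inserting the rest saves one edit over deleting it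
-- and inserting the whole block. This gives the cost p instead of p + 1.
Edits-expand : ∀ r x y v → Edits (suc r) (x ∷ v) (replicate (suc r) y ++ v)
Edits-expand r x y v = substitution [] x y v ∷ Edits-cons y (insert-replicate r y v)

levenshtein-≤ : ∀ {k z w} → Edits k z w → levenshtein z w ≤ k
levenshtein-≤ {k} {z} {w} = proj₂ (proj₂ (minimalEdits z w)) k

levenshtein-edits : ∀ z w → Edits (levenshtein z w) z w
levenshtein-edits z w = proj₁ (proj₂ (minimalEdits z w))

#b : Word → ℕ
#b []      = 0
#b (a ∷ w) = #b w
#b (b ∷ w) = suc (#b w)

#b-∷ : ∀ x w → #b w ≤ #b (x ∷ w)
#b-∷ a w = ≤-refl
#b-∷ b w = n≤1+n _

#b-∷′ : ∀ x w → #b (x ∷ w) ≤ suc (#b w)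
#b-∷′ a w = n≤1+n _
#b-∷′ b w = ≤-refl

#b-++ : ∀ u v → #b (u ++ v) ≡ #b u ℕ.+ #b v
#b-++ []      v = refl
#b-++ (a ∷ u) v = #b-++ u v
#b-++ (b ∷ u) v = cong suc (#b-++ u v)

#b-replicate-a : ∀ k → #b (replicate k a) ≡ 0
#b-replicate-a zero    = refl
#b-replicate-a (suc k) = #b-replicate-a k

#b-replicate-b : ∀ m → #b (replicate m b) ≡ m
#b-replicate-b zero    = refl
#b-replicate-b (suc m) = cong suc (#b-replicate-b m)

#b-context : ∀ u v w → #b v ≤ suc (#b w) → #b (u ++ v) ≤ suc (#b (u ++ w))
#b-context []      v w h = h
#b-context (a ∷ u) v w h = #b-context u v w h
#b-context (b ∷ u) v w h = s≤s (#b-context u v w h)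

#b-Edit : ∀ {z w} → Edit z w → #b z ≤ suc (#b w)
#b-Edit (substitution u x y v) = #b-context u (x ∷ v) (y ∷ v) (≤-trans (#b-∷′ x v) (s≤s (#b-∷ y v)))
#b-Edit (deletion u x v)       = #b-context u (x ∷ v) v (#b-∷′ x v)
#b-Edit (insertion u x v)      = #b-context u v (x ∷ v) (≤-trans (#b-∷ x v) (n≤1+n _))

-- Bounds distances from below. One inequality suffices, since `Edits-sym` supplies the other.
#b-Edits : ∀ {k z w} → Edits k z w → #b z ≤ k ℕ.+ #b w
#b-Edits []       = ≤-refl
#b-Edits (e ∷ es) = ≤-trans (#b-Edit e) (s≤s (#b-Edits es))

∼-reflexive : ∀ {n u v} → u ≡ v → u ∼⟨ n ⟩ v
∼-reflexive refl = ∼-refl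

-- Normal forms

-- Elements are themselves represented by words, so a factorization of x is simply a word congruent
-- to x.
π-identity : ∀ n z → π n z ≡ z
π-identity n []      = refl
π-identity n (x ∷ z) = cong (x ∷_) (π-identity n z)

-- The pair (k , m) stands for aᵏbᵐ.
form : ℕ × ℕ → Word → Word
form (k , m) v = replicate k a ++ replicate m b ++ v

normalForm≡form : ∀ n k m → normalForm n k m ≡ form (k , m) []
normalForm≡form n zero    zero    = refl
normalForm≡form n zero    (suc m) = cong (b ∷_) (normalForm≡form n zero m)
normalForm≡form n (suc k) m       = cong (a ∷_) (normalForm≡form n k m)

length-form : ∀ k m v → length (form (k , m) v) ≡ k ℕ.+ (m ℕ.+ length v)
length-form k m v =
  trans (length-++ (replicate k a))
    (cong₂ ℕ._+_ (length-replicate k)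
      (trans (length-++ (replicate m b)) (cong (ℕ._+ length v) (length-replicate m))))

#b-form : ∀ k m v → #b (form (k , m) v) ≡ m ℕ.+ #b v
#b-form k m v =
  trans (#b-++ (replicate k a) _)
    (trans (cong (ℕ._+ _) (#b-replicate-a k))
      (trans (#b-++ (replicate m b) v) (cong (ℕ._+ #b v) (#b-replicate-b m))))

-- The action of words on normal forms

module _ (p : ℕ) where

  -- Right multiplication by a letter in B (1 + p).
  act : ℕ × ℕ → Letter → ℕ × ℕ
  act (k , m)     b = k , suc m
  act (k , zero)  a = suc k , zero
  act (k , suc m) a = k , p ℕ.+ suc m

  nf : Word → ℕ × ℕ
  nf = foldl act (0 , 0)

  act-as : ∀ k₀ k v → foldl act (k₀ , 0) (replicate k a ++ v) ≡ foldl act (k ℕ.+ k₀ , 0) v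
  act-as k₀ zero    v = refl
  act-as k₀ (suc k) v =
    trans (act-as (suc k₀) k v) (cong (λ i → foldl act (i , 0) v) (+-suc k k₀))

  act-bs : ∀ k m₀ m v → foldl act (k , m₀) (replicate m b ++ v) ≡ foldl act (k , m ℕ.+ m₀) v
  act-bs k m₀ zero    v = refl
  act-bs k m₀ (suc m) v =
    trans (act-bs k (suc m₀) m v) (cong (λ i → foldl act (k , i) v) (+-suc m m₀))

  nf-form : ∀ s v → nf (form s v) ≡ foldl act s v
  nf-form (k , m) v =
    trans (act-as 0 k _)
      (trans (act-bs (k ℕ.+ 0) 0 m v)
        (cong (λ s → foldl act s v) (cong₂ _,_ (+-identityʳ k) (+-identityʳ m))))

  act-late-as : ∀ k m α → foldl act (k , suc m) (replicate α a) ≡ (k , suc m ℕ.+ α ℕ.* p)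
  act-late-as k m zero    = cong (k ,_) (sym (+-identityʳ _))
  act-late-as k m (suc α) = begin
    foldl act (k , p ℕ.+ suc m) (replicate α a)
      ≡⟨ cong (λ i → foldl act (k , i) (replicate α a)) (+-suc p m) ⟩
    foldl act (k , suc (p ℕ.+ m)) (replicate α a)
      ≡⟨ act-late-as k (p ℕ.+ m) α ⟩
    (k , suc (p ℕ.+ m ℕ.+ α ℕ.* p))
      ≡⟨ cong (λ i → k , suc (i ℕ.+ α ℕ.* p)) (+-comm p m) ⟩
    (k , suc (m ℕ.+ p ℕ.+ α ℕ.* p))
      ≡⟨ cong (λ i → k , suc i) (+-assoc m p (α ℕ.* p)) ⟩
    (k , suc (m ℕ.+ (p ℕ.+ α ℕ.* p))) ∎
    where open ≡-Reasoning

  -- If β = 0, trailing letters a would be read before any b and would raise k instead; the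
  -- disjunction excludes this.
  nf-witness : ∀ k β α → α ≡ 0 ⊎ 0 < β →
    nf (form (k , β) (replicate α a)) ≡ (k , β ℕ.+ α ℕ.* p)
  nf-witness k β       α (inj₁ refl) = trans (nf-form (k , β) []) (cong (k ,_) (sym (+-identityʳ β)))
  nf-witness k (suc β) α (inj₂ _)    = trans (nf-form (k , suc β) _) (act-late-as k β α)

  -- After a letter b the second exponent is positive, so the a in ba adds p, just as p further
  -- letters b do. The claim covers every initial state because in a product the second factor is
  -- read from the state left by the first.
  act-resp-∼ : ∀ {u v} → u ∼⟨ suc p ⟩ v → ∀ s → foldl act s u ≡ foldl act s v
  act-resp-∼ ba∼bⁿ (k , m) = begin
    (k , p ℕ.+ suc m)                             ≡⟨ act-bs k (suc m) p [] ⟨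
    foldl act (k , suc m) (replicate p b ++ [])   ≡⟨ cong (foldl act (k , suc m)) (++-identityʳ (replicate p b)) ⟩
    foldl act (k , suc m) (replicate p b)         ∎
    where open ≡-Reasoning
  act-resp-∼ ∼-refl s = refl
  act-resp-∼ (∼-sym e) s = sym (act-resp-∼ e s)
  act-resp-∼ (∼-trans e f) s = trans (act-resp-∼ e s) (act-resp-∼ f s)
  act-resp-∼ (∼-cong {u = u} {u′} {v} {v′} e f) s = begin
    foldl act s (u ++ v)            ≡⟨ foldl-++ act s u v ⟩
    foldl act (foldl act s u) v     ≡⟨ cong (λ t → foldl act t v) (act-resp-∼ e s) ⟩
    foldl act (foldl act s u′) v    ≡⟨ act-resp-∼ f _ ⟩
    foldl act (foldl act s u′) v′   ≡⟨ foldl-++ act s u′ v′ ⟨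
    foldl act s (u′ ++ v′)          ∎
    where open ≡-Reasoning

  -- α counts the letters a read when a letter b is already present.
  act-shape : ∀ k₀ m₀ w → ∃ λ α →
    proj₂ (foldl act (k₀ , m₀) w) ≡ m₀ ℕ.+ #b w ℕ.+ α ℕ.* p
    × k₀ ℕ.+ length w ≡ proj₁ (foldl act (k₀ , m₀) w) ℕ.+ (#b w ℕ.+ α)
    × (α ≡ 0 ⊎ 0 < m₀ ℕ.+ #b w)
  act-shape k₀ m₀ [] = 0 , sym (trans (+-identityʳ _) (+-identityʳ m₀)) , refl , inj₁ refl
  act-shape k₀ m₀ (b ∷ w) with act-shape k₀ (suc m₀) w
  ... | α , eqm , eqk , _ =
      α
    , trans eqm (cong (ℕ._+ α ℕ.* p) (sym (+-suc m₀ (#b w))))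
    , trans (+-suc k₀ _) (trans (cong suc eqk) (sym (+-suc _ _)))
    , inj₂ (subst (0 <_) (sym (+-suc m₀ (#b w))) (s≤s z≤n))
  act-shape k₀ zero (a ∷ w) with act-shape (suc k₀) zero w
  ... | α , eqm , eqk , cond = α , eqm , trans (+-suc k₀ _) eqk , cond
  act-shape k₀ (suc m₀) (a ∷ w) with act-shape k₀ (p ℕ.+ suc m₀) w
  ... | α , eqm , eqk , _ =
      suc α
    , trans eqm (regroup p (suc m₀) (#b w) (α ℕ.* p))
    , trans (+-suc k₀ _)
        (trans (cong suc eqk)
          (trans (sym (+-suc _ _)) (cong (proj₁ (foldl act (k₀ , p ℕ.+ suc m₀) w) ℕ.+_) (sym (+-suc _ α)))))
    , inj₂ (s≤s z≤n)
    where
    regroup : ∀ x y z t → x ℕ.+ y ℕ.+ z ℕ.+ t ≡ y ℕ.+ z ℕ.+ (x ℕ.+ t)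
    regroup = ℕ-Solver.solve-∀

  act-increasing : ∀ s w → proj₂ s ≤ proj₂ (foldl act s w)
  act-increasing (k , m) w with act-shape k m w
  ... | α , eqm , _ = subst (m ≤_) (sym eqm) (≤-trans (m≤m+n m _) (m≤m+n _ _))

  form-b : ∀ k m w → form (k , m) (b ∷ w) ≡ form (k , suc m) w
  form-b k m w = cong (replicate k a ++_) (replicate-shift m b w)

  form-bs : ∀ k m w → form (k , m) (replicate p b ++ w) ≡ form (k , p ℕ.+ m) w
  form-bs k m w = cong (replicate k a ++_) (replicate-merge p m b w)

  -- If m ≤ p, no letter a can follow a letter b.
  form-unique : ∀ s w → proj₂ (foldl act s w) ≤ p → form s w ≡ form (foldl act s w) []
  form-unique s           []      h = refl
  form-unique (k , m)     (b ∷ w) h = trans (form-b k m w) (form-unique (k , suc m) w h)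
  form-unique (k , zero)  (a ∷ w) h = trans (replicate-shift k a w) (form-unique (suc k , zero) w h)
  form-unique (k , suc m) (a ∷ w) h =
    ⊥-elim (m+1+n≰m p (≤-trans (act-increasing (k , p ℕ.+ suc m) w) h))

  -- The congruence keeps a chain among the factorizations of one element; the edit count bounds the
  -- distance of its steps.
  Move : Word → Word → Set
  Move z w = z ∼⟨ suc p ⟩ w × Edits p z w

  Move-sym : ∀ {z w} → Move z w → Move w z
  Move-sym (e , es) = ∼-sym e , Edits-sym es

  -- The defining relation is applied to the last b of the block together with the a; this is why
  -- the block must be nonempty.
  late-a∼bᵖ : ∀ m w → replicate (suc m) b ++ a ∷ w ∼⟨ suc p ⟩ replicate (suc m) b ++ replicate p b ++ w
  late-a∼bᵖ zero    w = ∼-cong ba∼bⁿ (∼-refl {u = w})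
  late-a∼bᵖ (suc m) w = ∼-cong (∼-refl {u = b ∷ []}) (late-a∼bᵖ m w)

-- Chains of moves, with r = n - 2

module _ (r : ℕ) where

  private
    p n : ℕ
    p = suc r
    n = suc p

  Move-late-a : ∀ k m w → Move p (form (k , suc m) (a ∷ w)) (form (k , p ℕ.+ suc m) w)
  Move-late-a k m w = subst (Move p _) (form-bs p k (suc m) w)
    ( ∼-cong (∼-refl {u = replicate k a}) (late-a∼bᵖ p m w)
    , Edits-++ˡ (replicate k a) (Edits-++ˡ (replicate (suc m) b) (Edits-expand r a b w)) )

  -- Induction on the unread part `w`, the part already read being in normal form. Only an a after a
  -- b costs a move; any other letter extends the normal form without changing the word.
  moves-to-form : ∀ s w → Star (Move p) (form s w) (form (foldl (act p) s w) [])
  moves-to-form s           []      = ε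
  moves-to-form (k , m)     (b ∷ w) rewrite form-b p k m w = moves-to-form (k , suc m) w
  moves-to-form (k , zero)  (a ∷ w) rewrite replicate-shift k a w = moves-to-form (suc k , zero) w
  moves-to-form (k , suc m) (a ∷ w) = Move-late-a k m w ◅ moves-to-form (k , p ℕ.+ suc m) w

  moves : ∀ z w → nf p z ≡ nf p w → Star (Move p) z w
  moves z w eq =
    subst (λ s → Star (Move p) z (form s [])) eq (moves-to-form (0 , 0) z)
      ◅◅ reverse (Move-sym p) (moves-to-form (0 , 0) w)

  moves⇒∼ : ∀ {z w} → Star (Move p) z w → z ∼⟨ n ⟩ w
  moves⇒∼ ε              = ∼-refl
  moves⇒∼ ((e , _) ◅ ms) = ∼-trans e (moves⇒∼ ms)

  factorization⇒nf : ∀ {x} z → IsFactorization n x z → nf p z ≡ nf p x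
  factorization⇒nf z e = trans (cong (nf p) (sym (π-identity n z))) (act-resp-∼ p e (0 , 0))

  -- Completeness of the invariant `nf`: both words are joined by moves through their common normal
  -- form, and each move is a congruence.
  nf⇒factorization : ∀ x z → nf p z ≡ nf p x → IsFactorization n x z
  nf⇒factorization x z eq = ∼-trans (∼-reflexive (π-identity n z)) (moves⇒∼ (moves z x eq))

  factorization-∼ : ∀ {x} z w → z ∼⟨ n ⟩ w → IsFactorization n x z → IsFactorization n x w
  factorization-∼ z w e f =
    ∼-trans (∼-reflexive (π-identity n w))
      (∼-trans (∼-sym e) (∼-trans (∼-reflexive (sym (π-identity n z))) f))

  -- The catenary degree

  moves⇒links : ∀ {x z w} → IsFactorization n x z → Star (Move p) z w →
    Star (Link n levenshtein x (fin p)) z w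
  moves⇒links f ε = ε
  moves⇒links f (_◅_ {z} {w} (e , es) ms) =
    (f , g , [ levenshtein-≤ es ]) ◅ moves⇒links g ms
    where g = factorization-∼ z w e f

  connected-p : ∀ x → ChainConnected n levenshtein x (fin p)
  connected-p x z w f g =
    moves⇒links f (moves z w (trans (factorization⇒nf z f) (sym (factorization⇒nf w g))))

  -- By `form-unique` there is a single factorization, so the empty chain serves. The exponent p
  -- itself is included, since a late a contributes p and needs one more b before it.
  connected-0 : ∀ x → proj₂ (nf p x) ≤ p → ChainConnected n levenshtein x (fin 0)
  connected-0 x h z w f g = subst (Star _ z) z≡w ε
    where
    canonical : ∀ y → IsFactorization n x y → y ≡ form (nf p x) []
    canonical y e = trans
      (form-unique p (0 , 0) y (subst (λ s → proj₂ s ≤ p) (sym (factorization⇒nf y e)) h))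
      (cong (λ s → form s []) (factorization⇒nf y e))
    z≡w : z ≡ w
    z≡w = trans (canonical z f) (sym (canonical w g))

  residue-gap : ∀ {β β′ α α′} → β ℕ.+ α ℕ.* p ≡ β′ ℕ.+ α′ ℕ.* p → α < α′ → p ℕ.+ β′ ≤ β
  residue-gap {β} {β′} {α} {α′} eq α<α′ = +-cancelʳ-≤ (α ℕ.* p) _ _ (begin
    p ℕ.+ β′ ℕ.+ α ℕ.* p     ≡⟨ cong (ℕ._+ α ℕ.* p) (+-comm p β′) ⟩
    β′ ℕ.+ p ℕ.+ α ℕ.* p     ≡⟨ +-assoc β′ p (α ℕ.* p) ⟩
    β′ ℕ.+ suc α ℕ.* p       ≤⟨ +-monoʳ-≤ β′ (*-monoˡ-≤ p α<α′) ⟩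
    β′ ℕ.+ α′ ℕ.* p          ≡⟨ eq ⟨
    β ℕ.+ α ℕ.* p            ∎)
    where open ≤-Reasoning

  -- β and β′ are congruent modulo p, so if distinct they differ by at least p (`residue-gap`),
  -- which is more than j.
  residue-unique : ∀ {j β β′ α α′} → β ℕ.+ α ℕ.* p ≡ β′ ℕ.+ α′ ℕ.* p → j < p →
    β ≤ j ℕ.+ β′ → β′ ≤ j ℕ.+ β → β ≡ β′
  residue-unique {j} {β} {β′} {α} {α′} eq j<p h h′ with <-cmp α α′
  ... | tri< α<α′ _ _ =
    ⊥-elim (<⇒≱ j<p (+-cancelʳ-≤ β′ p j (≤-trans (residue-gap {β} {β′} eq α<α′) h)))
  ... | tri≈ _ refl _ = +-cancelʳ-≡ (α ℕ.* p) β β′ eq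
  ... | tri> _ _ α>α′ =
    ⊥-elim (<⇒≱ j<p (+-cancelʳ-≤ β p j (≤-trans (residue-gap {β′} {β} (sym eq) α>α′) h′)))

  link-preserves-#b : ∀ x {j} z w → j < p → Link n levenshtein x (fin j) z w → #b z ≡ #b w
  link-preserves-#b x z w j<p (f , g , d≤j)
    with act-shape p 0 0 z | act-shape p 0 0 w
  ... | α , eqz , _ | α′ , eqw , _ = residue-unique {α = α} {α′}
    (trans (sym eqz) (trans (cong proj₂ (trans (factorization⇒nf z f) (sym (factorization⇒nf w g)))) eqw))
    -- The bound fed to `residue-unique` is the distance itself.
    (≤-<-trans ([≤]-injective d≤j) j<p)
    (#b-Edits (levenshtein-edits z w))
    (#b-Edits (Edits-sym (levenshtein-edits z w)))

  links-preserve-#b : ∀ x {j} z w → j < p → Star (Link n levenshtein x (fin j)) z w → #b z ≡ #b w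
  links-preserve-#b x z _ j<p ε                  = refl
  links-preserve-#b x z w j<p (_◅_ {j = y} l ls) =
    trans (link-preserves-#b x z y j<p l) (links-preserve-#b x y w j<p ls)

  -- Trading p letters b of aᵏbᵐ for one final a gives a factorization with fewer letters b, whereas
  -- chains with steps below p preserve their number.
  connected⇒p≤ : ∀ x N → p < proj₂ (nf p x) → ChainConnected n levenshtein x N → fin p ≤∞ N
  connected⇒p≤ x ⊤⁺     p<m conn = _ ≤⊤⁺
  connected⇒p≤ x [ j ]⁺ p<m conn with p ≤? j
  ... | yes p≤j = [ p≤j ]
  ... | no  p≰j = ⊥-elim (m+1+n≢m β (begin
      β ℕ.+ p                      ≡⟨ β+p≡m ⟩
      m                            ≡⟨ +-identityʳ m ⟨
      m ℕ.+ 0                      ≡⟨ #b-form k m [] ⟨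
      #b z₀                        ≡⟨ links-preserve-#b x z₀ z₁ (≰⇒> p≰j) (conn z₀ z₁ f₀ f₁) ⟩
      #b z₁                        ≡⟨ #b-form k β (a ∷ []) ⟩
      β ℕ.+ 0                      ≡⟨ +-identityʳ β ⟩
      β                            ∎))
    where
    open ≡-Reasoning
    k = proj₁ (nf p x)
    m = proj₂ (nf p x)
    -- As p < m, at least one b is left before the final a, so this a does add p to the exponent.
    β = m ∸ p
    β+p≡m : β ℕ.+ p ≡ m
    β+p≡m = m∸n+n≡m (<⇒≤ p<m)
    z₀ z₁ : Word
    z₀ = form (k , m) []
    z₁ = form (k , β) (a ∷ [])
    f₀ : IsFactorization n x z₀
    f₀ = nf⇒factorization x z₀ (nf-form p (k , m) [])
    f₁ : IsFactorization n x z₁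
    f₁ = nf⇒factorization x z₁ (trans (nf-witness p k β 1 (inj₂ (m<n⇒0<n∸m p<m)))
      (cong (k ,_) (trans (cong (β ℕ.+_) (+-identityʳ p)) β+p≡m)))

  -- Only the values 0 and p occur, according to whether the exponent of b exceeds p. The bound by p
  -- is carried along for the supremum.
  catenaryDegreeAt : ∀ x → ∃ λ N → IsCatenaryDegreeAt n levenshtein x N × N ≤∞ fin p
  catenaryDegreeAt x with p <? proj₂ (nf p x)
  ... | yes p<m = fin p , (connected-p x , λ N → connected⇒p≤ x N p<m) , [ ≤-refl ]
  ... | no  p≮m = fin 0 , (connected-0 x (≮⇒≥ p≮m) , λ N _ → 0≤∞ N) , [ z≤n ]
    where
    0≤∞ : ∀ N → fin 0 ≤∞ N
    0≤∞ ⊤⁺     = _ ≤⊤⁺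
    0≤∞ [ j ]⁺ = [ z≤n ]

  catenaryDegree : IsCatenaryDegree n levenshtein (fin p)
  catenaryDegree =
      (λ x → proj₁ (catenaryDegreeAt x))
    , (λ x → proj₁ (proj₂ (catenaryDegreeAt x)))
    , (λ x → proj₂ (proj₂ (catenaryDegreeAt x)))
    , λ u bound → ≤⁺-trans ≤-trans
        (connected⇒p≤ bⁿ _ p<m (proj₁ (proj₁ (proj₂ (catenaryDegreeAt bⁿ))))) (bound bⁿ)
    where
    -- The exponent n = p + 1 is the smallest one exceeding p, so the value p is attained here.
    bⁿ : Word
    bⁿ = form (0 , n) []
    p<m : p < proj₂ (nf p bⁿ)
    p<m = subst (λ s → p < proj₂ s) (sym (nf-form p (0 , n) [])) ≤-refl

  -- Sets of lengths

  -- The two sides of the defining relation are factorizations of one element, of lengths 2 and n.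
  halfFactorial⇒n≡2 : HalfFactorial n → n ≡ 2
  halfFactorial⇒n≡2 hf with hf (b ∷ a ∷ [])
  ... | l , _ , unique = trans (sym (unique bⁿ-length)) (unique (b ∷ a ∷ [] , ∼-refl , refl))
    where
    bⁿ-length : L n (b ∷ a ∷ []) n
    bⁿ-length =
      replicate n b , ∼-trans (∼-reflexive (π-identity n (replicate n b))) (∼-sym ba∼bⁿ) , length-replicate n

  nf-normalForm : ∀ k m → nf p (normalForm n k m) ≡ (k , m)
  nf-normalForm k m = trans (cong (nf p) (normalForm≡form n k m)) (nf-form p (k , m) [])

  L⇒parameters : ∀ k m {l} → L n (normalForm n k m) l →
    ∃ λ α → ∃ λ β → m ≡ β ℕ.+ α ℕ.* p × l ≡ k ℕ.+ (β ℕ.+ α) × (α ≡ 0 ⊎ 0 < β)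
  L⇒parameters k m (z , f , refl) with act-shape p 0 0 z
  ... | α , eqm , eqk , cond =
    α , #b z , trans (sym (cong proj₂ nfz)) eqm , trans eqk (cong (ℕ._+ (#b z ℕ.+ α)) (cong proj₁ nfz)) , cond
    where
    nfz : nf p z ≡ (k , m)
    nfz = trans (factorization⇒nf z f) (nf-normalForm k m)

  parameters⇒L : ∀ k α β → α ≡ 0 ⊎ 0 < β → L n (normalForm n k (β ℕ.+ α ℕ.* p)) (k ℕ.+ (β ℕ.+ α))
  parameters⇒L k α β cond =
      z
    , nf⇒factorization (normalForm n k m) z (trans (nf-witness p k β α cond) (sym (nf-normalForm k m)))
    , trans (length-form k β _) (cong (λ i → k ℕ.+ (β ℕ.+ i)) (length-replicate α))
    where
    m = β ℕ.+ α ℕ.* p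
    -- Once a b has been read, the order of the remaining letters does not affect the state, so all
    -- late letters a may stand at the end.
    z = form (k , β) (replicate α a)

  -- The inequality αp < m is strict because β > 0. When p divides m, this rules out α = m / p and
  -- accounts for the -1 in `q`; otherwise the floor is already sharp.
  admissible⇒≤q : ∀ α m .(2≤n : 2 ≤ n) → α ≡ 0 ⊎ α ℕ.* p < m → α ≤ q m n 2≤n
  admissible⇒≤q α m       2≤n (inj₁ refl) = z≤n
  admissible⇒≤q α (suc m) 2≤n (inj₂ h) with p ∣? suc m
  ... | yes p∣m = <⇒≤pred (*-cancelʳ-< p α (suc m ℕ./ p) (subst (α ℕ.* p <_) (sym (m/n*n≡m p∣m)) h))
  ... | no  _   = subst (_≤ suc m ℕ./ p) (m*n/n≡m α p) (/-monoˡ-≤ p (<⇒≤ h))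

  ≤q⇒admissible : ∀ α m .(2≤n : 2 ≤ n) → α ≤ q m n 2≤n → α ≡ 0 ⊎ α ℕ.* p < m
  ≤q⇒admissible zero    m       2≤n h = inj₁ refl
  ≤q⇒admissible (suc α) (suc m) 2≤n h with p ∣? suc m
  ... | yes p∣m = inj₂ (subst (suc α ℕ.* p <_) (m/n*n≡m p∣m) (*-monoˡ-< p (≤pred⇒< (suc m ℕ./ p) h)))
    where
    ≤pred⇒< : ∀ {i} j → suc i ≤ j ∸ 1 → suc i < j
    ≤pred⇒< (suc j) h = s≤s h
  -- The floor gives only a weak inequality; equality would make p divide m.
  ... | no  p∤m = inj₂ (≤∧≢⇒< (≤-trans (*-monoˡ-≤ p h) (m/n*n≤m (suc m) p)) λ eq → p∤m (divides (suc α) (sym eq)))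

  -- The element i of [0, q] corresponds to α = q − i.
  length-identity : ∀ k β α i →
    + (k ℕ.+ (β ℕ.+ α)) ≡ (+ k + + (β ℕ.+ α ℕ.* p)) - + (α ℕ.+ i) * + r + + r * + i
  length-identity k β α i =
    trans (identity (+ k) (+ β) (+ α) (+ i) (+ r))
      (cong (λ t → (+ k + (+ β + t)) - + (α ℕ.+ i) * + r + + r * + i) (sym (pos-* α p)))
    where
    identity : ∀ k β α i r →
      k + (β + α) ≡ (k + (β + α * (+ 1 + r))) - (α + i) * r + r * i
    identity = solve-∀

  lengths : (2≤n : 2 ≤ n) (k m : ℕ) →
    asℤ (L n (normalForm n k m))
      ≐ ((+ k + + m) - + q m n 2≤n * + r) +ˢ + r ·ˢ [ + 0 ⋯ + q m n 2≤n ]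
  lengths 2≤n k m = ⊆ , ⊇
    where
    Q = q m n 2≤n
    ⊆ : ∀ {z} → asℤ (L n (normalForm n k m)) z → (((+ k + + m) - + Q * + r) +ˢ + r ·ˢ [ + 0 ⋯ + Q ]) z
    ⊆ (l , l∈L , refl) with L⇒parameters k m l∈L
    ... | α , β , eqm , refl , cond =
        + r * + i , (+ i , (+≤+ z≤n , +≤+ (m∸n≤m Q α)) , refl)
      , trans (length-identity k β α i)
          (cong₂ (λ s t → (+ k + + s) - + t * + r + + r * + i) (sym eqm) (m+[n∸m]≡n α≤Q))
      where
      i = Q ∸ α
      α≤Q : α ≤ Q
      α≤Q = admissible⇒≤q α m 2≤n
        (map₂ (λ 0<β → subst (α ℕ.* p <_) (sym eqm) (m<n+m (α ℕ.* p) 0<β)) cond)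
    ⊇ : ∀ {z} → (((+ k + + m) - + Q * + r) +ˢ + r ·ˢ [ + 0 ⋯ + Q ]) z → asℤ (L n (normalForm n k m)) z
    ⊇ (_ , (_ , (+≤+ {n = i} _ , +≤+ i≤Q) , refl) , refl) =
        k ℕ.+ (β ℕ.+ α)
      , subst (λ j → L n (normalForm n k j) (k ℕ.+ (β ℕ.+ α))) eqm (parameters⇒L k α β (proj₂ bounds))
      , sym (trans (length-identity k β α i)
          (cong₂ (λ s t → (+ k + + s) - + t * + r + + r * + i) eqm (m∸n+n≡m i≤Q)))
      where
      α = Q ∸ i
      -- By `bounds` nothing is truncated. The alternative α = 0 there also covers m = 0, where β =
      -- 0.
      β = m ∸ α ℕ.* p
      bounds : α ℕ.* p ≤ m × (α ≡ 0 ⊎ 0 < β)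
      bounds with ≤q⇒admissible α m 2≤n (m∸n≤m Q i)
      ... | inj₁ α≡0 = subst (λ j → j ℕ.* p ≤ m) (sym α≡0) z≤n , inj₁ α≡0
      ... | inj₂ αp<m = <⇒≤ αp<m , inj₂ (m<n⇒0<n∸m αp<m)
      eqm : β ℕ.+ α ℕ.* p ≡ m
      eqm = m∸n+n≡m (proj₁ bounds)

-- For n = 2 the relation reads ba = bb, whose sides have equal length.
length-resp-∼ : ∀ {u v} → u ∼⟨ 2 ⟩ v → length u ≡ length v
length-resp-∼ ba∼bⁿ         = refl
length-resp-∼ ∼-refl        = refl
length-resp-∼ (∼-sym e)     = sym (length-resp-∼ e)
length-resp-∼ (∼-trans e f) = trans (length-resp-∼ e) (length-resp-∼ f)
length-resp-∼ (∼-cong {u = u} {u′} e f) =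
  trans (length-++ u) (trans (cong₂ ℕ._+_ (length-resp-∼ e) (length-resp-∼ f)) (sym (length-++ u′)))

halfFactorial-2 : HalfFactorial 2
halfFactorial-2 x =
    length x
  , (x , ∼-reflexive (π-identity 2 x) , refl)
  , λ { (z , f , refl) → sym (trans (cong length (sym (π-identity 2 z))) (length-resp-∼ f)) }

theorem4p1 : (n : ℕ) (2≤n : 2 ≤ n) →
    (IsCatenaryDegree n levenshtein (fin (n ∸ 1)) × (HalfFactorial n ⇔ n ≡ 2))
    × (∀ (k m : ℕ) →
    asℤ (L n (normalForm n k m))
    ≐ ((+ k + + m) - + q m n 2≤n * (+ n - + 2))
    +ˢ (+ n - + 2) ·ˢ [ + 0 ⋯ + q m n 2≤n ])
theorem4p1 (suc (suc r)) 2≤n@(s≤s (s≤s _)) =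
  -- With n = r + 2 exposed, `+ n - + 2` computes to the `+ r` of `lengths`, and `n ∸ 1` to `suc r`.
  (catenaryDegree r , mk⇔ (halfFactorial⇒n≡2 r) λ { refl → halfFactorial-2 }) , lengths r 2≤n
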